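{- Let $G$ be a $k$-regular graph on $n$ vertices, let $\lambda$ be an MCSD of $G$, and let $\gamma_1<\cdots<\gamma_{\lceil k/2\rceil}$ be the labels used by $\lambda$ that are no greater than $n/2$. Let $\alpha<n/2$ be an integer with $\gcd(\alpha,n)=1$. For $1\le i\le\lceil k/2\rceil$, let $$\gamma_i'=\begin{cases}\alpha\cdot_n\gamma_i & \text{if } \alpha\cdot_n\gamma_i\le n/2,\\ n-\alpha\cdot_n\gamma_i & \text{if } \alpha\cdot_n\gamma_i>n/2.\end{cases}$$ Then the labeling $\lambda'$ drawing on the label set $\{\gamma_1',\ldots,\gamma_{\lceil k/2\rceil}'\}$ is also an MCSD of $G$; that is, $G$ admits an MCSD $\lambda'$ whose labels that are no greater than $n/2$ are exactly $\gamma_1',\ldots,\gamma_{\lceil k/2\rceil}'$, these being pairwise distinct.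
   Context: Graphs are finite, undirected, without multiple edges or self-loops. An edge labeling $\lambda$ of $G$ assigns to every edge $uv$ two labels, $\lambda_u(uv)$ corresponding to $u$ and $\lambda_v(uv)$ corresponding to $v$. It is a chordal sense of direction (CSD) if there is a cyclic ordering of the vertices, i.e. a bijection $r:V(G)\to\{0,\ldots,n-1\}$ (the rank), such that for every edge $uv$ the label $\lambda_u(uv)\in\{1,\ldots,n-1\}$ equals $r(v)-r(u)$ modulo $n$ (and likewise $\lambda_v(uv)$ equals $r(u)-r(v)$ modulo $n$). It is a minimal chordal sense of direction (MCSD) if moreover the total number of distinct labels used is exactly $\Delta(G)$, the maximum degree of $G$; thus for $k$-regular $G$ exactly $k$ labels are used. The set of labels used by a CSD is closed under $\gamma\mapsto n-\gamma$; for an MCSD of a $k$-regular graph exactly $\lceil k/2\rceil$ of the $k$ labels are no greater than $n/2$ (with $n/2$ itself a label if and only if $k$ is odd), and an MCSD is referred to by giving just these labels (the label set it "draws on"). The operator $\cdot_n$ denotes multiplication modulo $n$, with result in $\{0,\ldots,n-1\}$. -}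

module Defs where

open import Data.Bool.Base using (if_then_else_)
open import Data.Fin.Base using (Fin; toℕ)
open import Data.Fin.Permutation using (Permutation′; _⟨$⟩ʳ_)
open import Data.Integer.Base as ℤ using (ℤ; +_)
open import Data.Integer.DivMod using (_%ℕ_)
open import Data.Integer.Divisibility using () renaming (_∣_ to _∣ℤ_)
open import Data.List.Base using (List; length; map; filter; allFin)
open import Data.List.Membership.Propositional using (_∈_)
open import Data.List.Relation.Unary.Unique.Propositional using (Unique)
open import Data.Nat.Base using (ℕ; NonZero; _*_; _∸_; _≤_; _<_)
open import Data.Nat.Properties using (_≤?_; ≤-totalOrder)
open import Data.List.Extrema ≤-totalOrder using (max)
open import Data.Product.Base using (Σ-syntax; ∃; ∃-syntax; _×_)
open import Function.Bundles using (_⇔_)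
open import Relation.Binary.Core using (Rel)
open import Relation.Binary.Definitions using (Decidable; Irreflexive; Symmetric)
open import Relation.Binary.PropositionalEquality.Core using (_≡_)
open import Relation.Nullary.Decidable.Core using (does)
open import Level using (0ℓ)

record Graph (n : ℕ) : Set₁ where
  infix 4 _∼_ _∼?_
  field
    _∼_  : Rel (Fin n) 0ℓ
    _∼?_ : Decidable _∼_
    sym    : Symmetric _∼_
    irrefl : Irreflexive _≡_ _∼_

module _ {n : ℕ} (G : Graph n) where
  open Graph G

  degree : Fin n → ℕ
  degree u = length (filter (u ∼?_) (allFin n))

  Δ : ℕ
  Δ = max 0 (map degree (allFin n))

  Regular : ℕ → Set
  Regular k = ∀ u → degree u ≡ k

  -- `lab u v e` is the label λ_u(uv) of the edge uv at its endpoint u, so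
  -- `lab u v` and `lab v u` are the two labels of one edge.  The adjacency
  -- proof is irrelevant, so labels depend on the edge only.
  EdgeLabeling : Set
  EdgeLabeling = ∀ u v → .(u ∼ v) → ℕ

  Used : EdgeLabeling → ℕ → Set
  Used lab γ = ∃[ u ] ∃[ v ] Σ[ e ∈ u ∼ v ] lab u v e ≡ γ

HasSize : (ℕ → Set) → ℕ → Set
HasSize P m = Σ[ xs ∈ List ℕ ] Unique xs × length xs ≡ m × (∀ x → x ∈ xs ⇔ P x)

infix 4 _≡_[mod_]
_≡_[mod_] : ℤ → ℤ → ℕ → Set
a ≡ b [mod n ] = + n ∣ℤ (a ℤ.- b)

record IsCSD {n : ℕ} (G : Graph n) (lab : EdgeLabeling G) : Set where
  open Graph G
  field
    rank : Permutation′ n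

  r : Fin n → ℤ
  r u = + toℕ (rank ⟨$⟩ʳ u)

  field
    label-range : ∀ u v (e : u ∼ v) → 1 ≤ lab u v e × lab u v e < n
    label-diff  : ∀ u v (e : u ∼ v) → + lab u v e ≡ r v ℤ.- r u [mod n ]

record IsMCSD {n : ℕ} (G : Graph n) (lab : EdgeLabeling G) : Set where
  field
    isCSD   : IsCSD G lab
    minimal : HasSize (Used G lab) (Δ G)

-- The labels used that are no greater than n/2 are exactly the values of γ.
DrawsOn : ∀ {n m} (G : Graph n) → EdgeLabeling G → (Fin m → ℕ) → Set
DrawsOn {n} G lab γ = ∀ x → (∃ λ i → γ i ≡ x) ⇔ (Used G lab x × 2 * x ≤ n)

mulMod : (n : ℕ) .{{_ : NonZero n}} → ℤ → ℕ → ℕ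
mulMod n α γ = (α ℤ.* + γ) %ℕ n

rescale : (n : ℕ) .{{_ : NonZero n}} → ℤ → ℕ → ℕ
rescale n α γ = if does (2 * x ≤? n) then x else n ∸ x
  where
  x : ℕ
  x = mulMod n α γ

{-# OPTIONS --safe #-}
-- Multiplication by α is a bijection of ℤ/n, its inverse being multiplication
-- by a Bézout coefficient β.  Composing the ranks of λ with it gives a cyclic
-- ordering whose labels are the α ·ₙ γ, equally many as those of λ.  The two
-- labels of an edge sum to n, so the labels of λ′ at most n/2 are the α ·ₙ γ
-- folded at n/2, and folded labels α ·ₙ γᵢ, α ·ₙ γⱼ agree only if γᵢ = γⱼ or
-- γᵢ + γⱼ = n; the latter makes both n/2.
module Submission where

open import Defs
open import Data.Bool.Base using (if_then_else_)
open import Data.Fin.Base as Fin using (Fin; fromℕ<; toℕ)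
open import Data.Fin.Permutation using (Permutation′; permutation; _∘ₚ_; _⟨$⟩ʳ_)
open import Data.Fin.Properties as Fin using (toℕ-fromℕ<; toℕ-injective; toℕ<n)
open import Data.Integer.Base as ℤ using (ℤ; +_; 1ℤ)
open import Data.Integer.DivMod using (_%ℕ_; _/ℕ_; n%ℕd<d; a≡a%ℕn+[a/ℕn]*n)
open import Data.Integer.Divisibility.Signed
  using (divides; ∣ᵤ⇒∣; ∣⇒∣ᵤ; m∣∣m∣; ∣m∣n⇒∣m+n; ∣m⇒∣-m; ∣n⇒∣m*n) renaming (_∣_ to _∣ₛ_)
open import Data.Integer.GCD using (gcd)
import Data.Integer.Properties as ℤ
open import Data.Integer.Tactic.RingSolver using (solve-∀)
open import Data.List.Base using (map)
open import Data.List.Membership.Propositional.Properties using (∈-map⁺; ∈-map⁻)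
open import Data.List.Properties using (length-map)
open import Data.List.Relation.Unary.All as All using (All; []; _∷_)
import Data.List.Relation.Unary.All.Properties as All
open import Data.List.Relation.Unary.AllPairs using ([]; _∷_)
open import Data.List.Relation.Unary.Unique.Propositional using (Unique)
open import Data.Nat.Base
  using (ℕ; NonZero; suc; ⌈_/2⌉; _+_; _*_; _∸_; _≤_; _<_; z≤n)
open import Data.Nat.Coprimality using (gcd≡1⇒coprime; coprime-Bézout)
open import Data.Nat.Divisibility using (n∣m⇒m%n≡0) renaming (divides to dividesℕ)
open import Data.Nat.DivMod using (m<n⇒m%n≡m)
open import Data.Nat.GCD using (module Bézout)
open import Data.Nat.Properties
open import Data.Product.Base using (Σ-syntax; ∃; _×_; _,_; proj₁; proj₂)
open import Function.Base using (_∘_)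
open import Function.Bundles using (mk⇔; Equivalence)
open import Function.Definitions using (Injective)
open import Relation.Binary.Core using (_Preserves_⟶_)
open import Relation.Binary.Definitions using (tri<; tri≈; tri>)
open import Relation.Binary.PropositionalEquality
open import Relation.Nullary.Decidable using (yes; no; dec-true; dec-false)
open import Relation.Nullary.Negation using (¬_; contradiction)

open Equivalence using (to; from)

-- Congruences modulo `n` and modular inverses.

-- `_≡_[mod_]` unfolds to divisibility of absolute values in ℕ, from which `a` and `b` cannot be
-- inferred; hence the explicit arguments throughout. The signed relation offers quotients in ℤ and
-- closure under sums.
∣⇒mod : ∀ {n} a b → + n ∣ₛ a ℤ.- b → a ≡ b [mod n ]
∣⇒mod _ _ = ∣⇒∣ᵤ

mod⇒∣ : ∀ {n} a b → a ≡ b [mod n ] → + n ∣ₛ a ℤ.- b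
mod⇒∣ _ _ = ∣ᵤ⇒∣

mod-sym : ∀ {n} a b → a ≡ b [mod n ] → b ≡ a [mod n ]
mod-sym {n} a b p =
  ∣⇒mod b a (subst (+ n ∣ₛ_) (lemma a b) (∣m⇒∣-m (mod⇒∣ a b p)))
  where
  lemma : ∀ a b → ℤ.- (a ℤ.- b) ≡ b ℤ.- a
  lemma = solve-∀

mod-trans : ∀ {n} a b c → a ≡ b [mod n ] → b ≡ c [mod n ] → a ≡ c [mod n ]
mod-trans {n} a b c p q =
  ∣⇒mod a c (subst (+ n ∣ₛ_) (lemma a b c)
    (∣m∣n⇒∣m+n (mod⇒∣ a b p) (mod⇒∣ b c q)))
  where
  lemma : ∀ a b c → (a ℤ.- b) ℤ.+ (b ℤ.- c) ≡ a ℤ.- c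
  lemma = solve-∀

mod-+-cong : ∀ {n} a b c d → a ≡ b [mod n ] → c ≡ d [mod n ] → a ℤ.+ c ≡ b ℤ.+ d [mod n ]
mod-+-cong {n} a b c d p q =
  ∣⇒mod (a ℤ.+ c) (b ℤ.+ d) (subst (+ n ∣ₛ_) (lemma a b c d)
    (∣m∣n⇒∣m+n (mod⇒∣ a b p) (mod⇒∣ c d q)))
  where
  lemma : ∀ a b c d → (a ℤ.- b) ℤ.+ (c ℤ.- d) ≡ (a ℤ.+ c) ℤ.- (b ℤ.+ d)
  lemma = solve-∀

mod-*-congˡ : ∀ {n} c a b → a ≡ b [mod n ] → c ℤ.* a ≡ c ℤ.* b [mod n ]
mod-*-congˡ {n} c a b p =
  ∣⇒mod (c ℤ.* a) (c ℤ.* b) (subst (+ n ∣ₛ_) (lemma c a b)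
    (∣n⇒∣m*n c (mod⇒∣ a b p)))
  where
  lemma : ∀ c a b → c ℤ.* (a ℤ.- b) ≡ c ℤ.* a ℤ.- c ℤ.* b
  lemma = solve-∀

mod-neg-cong : ∀ {n} a b → a ≡ b [mod n ] → ℤ.- a ≡ ℤ.- b [mod n ]
mod-neg-cong {n} a b p =
  ∣⇒mod (ℤ.- a) (ℤ.- b) (subst (+ n ∣ₛ_) (ℤ.neg-distrib-+ a (ℤ.- b))
    (∣m⇒∣-m (mod⇒∣ a b p)))

-- The distance of `x` and `y` is at most the larger of the two, hence below `n`. It is therefore
-- its own remainder, and divisibility makes that remainder 0.
mod-residue-unique : ∀ {n} .{{_ : NonZero n}} {x y} → x < n → y < n →
                     + x ≡ + y [mod n ] → x ≡ y
mod-residue-unique {n} {x} {y} x<n y<n n∣x-y =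
  ℤ.+-injective (ℤ.i-j≡0⇒i≡j (+ x) (+ y) (ℤ.∣i∣≡0⇒i≡0
    (trans (sym (m<n⇒m%n≡m small)) (n∣m⇒m%n≡0 _ n n∣x-y))))
  where
  small : ℤ.∣ + x ℤ.- + y ∣ < n
  small = subst (λ z → ℤ.∣ z ∣ < n) (sym (ℤ.[+m]-[+n]≡m⊖n x y))
            (≤-<-trans (ℤ.∣m⊝n∣≤m⊔n x y) (⊔-lub x<n y<n))

-- Bézout's identity over ℕ concerns `∣α∣`. The factor `q` with `∣α∣ = q α` restores the sign
-- without a case split on `α`.
mod-inverse : ∀ n α → gcd α (+ n) ≡ 1ℤ → ∃ λ β → β ℤ.* α ≡ 1ℤ [mod n ]
mod-inverse n α gcd≡1
  with coprime-Bézout (gcd≡1⇒coprime {ℤ.∣ α ∣} {n} (ℤ.+-injective gcd≡1)) | m∣∣m∣ {α}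
... | Bézout.+- x y eq | divides q ∣α∣≡qα =
  + x ℤ.* q , ∣⇒mod (+ x ℤ.* q ℤ.* α) 1ℤ (divides (+ y) (begin
    + x ℤ.* q ℤ.* α ℤ.- 1ℤ          ≡⟨ cong (ℤ._- 1ℤ) (ℤ.*-assoc (+ x) q α) ⟩
    + x ℤ.* (q ℤ.* α) ℤ.- 1ℤ        ≡⟨ cong (λ z → + x ℤ.* z ℤ.- 1ℤ) ∣α∣≡qα ⟨
    + x ℤ.* + ℤ.∣ α ∣ ℤ.- 1ℤ        ≡⟨ cong (ℤ._- 1ℤ) (ℤ.pos-* x _) ⟨
    + (x * ℤ.∣ α ∣) ℤ.- 1ℤ          ≡⟨ cong (λ z → + z ℤ.- 1ℤ) eq ⟨
    1ℤ ℤ.+ + (y * n) ℤ.- 1ℤ         ≡⟨ lemma (+ (y * n)) ⟩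
    + (y * n)                       ≡⟨ ℤ.pos-* y n ⟩
    + y ℤ.* + n                     ∎))
  where
  open ≡-Reasoning
  lemma : ∀ a → 1ℤ ℤ.+ a ℤ.- 1ℤ ≡ a
  lemma = solve-∀
... | Bézout.-+ x y eq | divides q ∣α∣≡qα =
  -- Here `1 + x ∣α∣ = y n`, so `- x` inverts `∣α∣`.
  ℤ.- (+ x ℤ.* q) , ∣⇒mod (ℤ.- (+ x ℤ.* q) ℤ.* α) 1ℤ (divides (ℤ.- + y) (begin
    ℤ.- (+ x ℤ.* q) ℤ.* α ℤ.- 1ℤ       ≡⟨ lemma (+ x) q α ⟩
    ℤ.- (1ℤ ℤ.+ + x ℤ.* (q ℤ.* α))     ≡⟨ cong (λ z → ℤ.- (1ℤ ℤ.+ + x ℤ.* z)) ∣α∣≡qα ⟨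
    ℤ.- (1ℤ ℤ.+ + x ℤ.* + ℤ.∣ α ∣)     ≡⟨ cong (λ z → ℤ.- (1ℤ ℤ.+ z)) (ℤ.pos-* x _) ⟨
    ℤ.- + (1 + x * ℤ.∣ α ∣)            ≡⟨ cong (λ z → ℤ.- + z) eq ⟩
    ℤ.- + (y * n)                      ≡⟨ cong ℤ.-_ (ℤ.pos-* y n) ⟩
    ℤ.- (+ y ℤ.* + n)                  ≡⟨ ℤ.neg-distribˡ-* (+ y) (+ n) ⟩
    ℤ.- + y ℤ.* + n                    ∎))
  where
  open ≡-Reasoning
  lemma : ∀ a b c → ℤ.- (a ℤ.* b) ℤ.* c ℤ.- 1ℤ ≡ ℤ.- (1ℤ ℤ.+ a ℤ.* (b ℤ.* c))
  lemma = solve-∀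

-- Injectivity, and complements with respect to n/2.

-- Injectivity is asked for only on `P`: multiplication modulo `n` is injective on residues below
-- `n`, not on all of ℕ.
Unique-map⁺ : ∀ {A B : Set} {P : A → Set} {f : A → B} →
              (∀ {x y} → P x → P y → f x ≡ f y → x ≡ y) →
              ∀ {xs} → All P xs → Unique xs → Unique (map f xs)
Unique-map⁺ f-inj []         []           = []
Unique-map⁺ f-inj (px ∷ pxs) (x∉xs ∷ xs!) =
  All.map⁺ (All.map (λ (x≢y , py) → x≢y ∘ f-inj px py) (All.zip (x∉xs , pxs)))
    ∷ Unique-map⁺ f-inj pxs xs!

monotone⇒injective : ∀ {m} (γ : Fin m → ℕ) → γ Preserves Fin._<_ ⟶ _<_ → Injective _≡_ _≡_ γ
monotone⇒injective γ mono {i} {j} γi≡γj with Fin.<-cmp i j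
... | tri< i<j _ _ = contradiction γi≡γj (<⇒≢ (mono i<j))
... | tri≈ _ i≡j _ = i≡j
... | tri> _ _ j<i = contradiction (sym γi≡γj) (<⇒≢ (mono j<i))

module _ {n : ℕ} {a b : ℕ} where
  -- Once `n` is `a + b`, cancellation leaves `a ≤ b` and `b ≤ a`. This settles the boundary value
  -- n/2, which is its own complement.
  halves-equal : 2 * a ≤ n → 2 * b ≤ n → a + b ≡ n → a ≡ b
  halves-equal 2a≤n 2b≤n refl =
    ≤-antisym (+-cancelˡ-≤ a a b (subst (λ z → a + z ≤ a + b) (+-identityʳ a) 2a≤n))
              (+-cancelʳ-≤ b b a (subst (λ z → b + z ≤ a + b) (+-identityʳ b) 2b≤n))

  complement-small : a + b ≡ n → ¬ 2 * a ≤ n → 2 * b ≤ n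
  complement-small refl 2a≰n =
    subst (λ z → b + z ≤ a + b) (sym (+-identityʳ b)) (+-monoˡ-≤ b b≤a)
    where
    b≤a : b ≤ a
    b≤a = <⇒≤ (+-cancelˡ-< a b a (subst (λ z → a + b < a + z) (+-identityʳ a) (≰⇒> 2a≰n)))

-- Multiplication on residues modulo `n`.

module _ (n : ℕ) .{{_ : NonZero n}} where

  mulMod<n : ∀ α x → mulMod n α x < n
  mulMod<n α x = n%ℕd<d (α ℤ.* + x) n

  mulMod-cong : ∀ α x → + mulMod n α x ≡ α ℤ.* + x [mod n ]
  mulMod-cong α x = mod-sym (α ℤ.* + x) (+ mulMod n α x)
    (∣⇒mod a (+ mulMod n α x) (divides (a /ℕ n)
      (trans (cong (ℤ._- + mulMod n α x) (a≡a%ℕn+[a/ℕn]*n a n))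
             (lemma (+ mulMod n α x) ((a /ℕ n) ℤ.* + n)))))
    where
    a = α ℤ.* + x
    lemma : ∀ r s → r ℤ.+ s ℤ.- r ≡ s
    lemma = solve-∀

  -- Both sides are residues, so a congruence suffices; it is `β α ≡ 1` multiplied by `x`.
  mulMod-inverse : ∀ {α β x} → β ℤ.* α ≡ 1ℤ [mod n ] → x < n →
                   mulMod n β (mulMod n α x) ≡ x
  mulMod-inverse {α} {β} {x} βα≡1 x<n = mod-residue-unique (mulMod<n β (mulMod n α x)) x<n
    (mod-trans (+ mulMod n β (mulMod n α x)) (β ℤ.* + mulMod n α x) (+ x)
      (mulMod-cong β (mulMod n α x))
    (mod-trans (β ℤ.* + mulMod n α x) (β ℤ.* (α ℤ.* + x)) (+ x)
      (mod-*-congˡ β (+ mulMod n α x) (α ℤ.* + x) (mulMod-cong α x))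
    (subst₂ (λ y z → y ≡ z [mod n ]) (lemma β α (+ x)) (ℤ.*-identityʳ (+ x))
      (mod-*-congˡ (+ x) (β ℤ.* α) 1ℤ βα≡1))))
    where
    lemma : ∀ b a c → c ℤ.* (b ℤ.* a) ≡ b ℤ.* (a ℤ.* c)
    lemma = solve-∀

  rescale-small : ∀ α x → 2 * mulMod n α x ≤ n → rescale n α x ≡ mulMod n α x
  rescale-small α x small =
    cong (if_then mulMod n α x else n ∸ mulMod n α x) (dec-true (2 * mulMod n α x ≤? n) small)

  rescale-large : ∀ α x → ¬ 2 * mulMod n α x ≤ n → rescale n α x ≡ n ∸ mulMod n α x
  rescale-large α x large =
    cong (if_then mulMod n α x else n ∸ mulMod n α x) (dec-false (2 * mulMod n α x ≤? n) large)

-- The two labels of an edge.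

module _ {n : ℕ} {G : Graph n} {lab : EdgeLabeling G} (csd : IsCSD G lab) where
  open Graph G using (_∼_) renaming (sym to ∼-sym)
  open IsCSD csd

  -- The two labels are congruent to opposite rank differences, so `n` divides their sum. The sum is
  -- at least 1 and below `2 * n`, which leaves only the quotient 1.
  reverse-label : ∀ {u v} (e : u ∼ v) → lab u v e + lab v u (∼-sym e) ≡ n
  reverse-label {u} {v} e
    with subst (+ n ∣ₛ_) difference
           (mod⇒∣ (+ a ℤ.+ + b) ((r v ℤ.- r u) ℤ.+ (r u ℤ.- r v)) sum≡0)
    where
    a = lab u v e
    b = lab v u (∼-sym e)
    sum≡0 : + a ℤ.+ + b ≡ (r v ℤ.- r u) ℤ.+ (r u ℤ.- r v) [mod n ]
    sum≡0 = mod-+-cong (+ a) (r v ℤ.- r u) (+ b) (r u ℤ.- r v)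
              (label-diff u v e) (label-diff v u (∼-sym e))
    lemma : ∀ a x y → a ℤ.- ((y ℤ.- x) ℤ.+ (x ℤ.- y)) ≡ a
    lemma = solve-∀
    difference : (+ a ℤ.+ + b) ℤ.- ((r v ℤ.- r u) ℤ.+ (r u ℤ.- r v)) ≡ + (a + b)
    difference = lemma (+ a ℤ.+ + b) (r u) (r v)
  ... | n∣a+b with ∣⇒∣ᵤ n∣a+b
  ...   | dividesℕ 0 eq =
    contradiction eq (>⇒≢ (≤-trans (proj₁ (label-range u v e)) (m≤m+n _ _)))
  ...   | dividesℕ 1 eq = trans eq (*-identityˡ n)
  ...   | dividesℕ (suc (suc q)) eq = contradiction eq (<⇒≢ (<-≤-trans
    (+-mono-< (proj₂ (label-range u v e)) (proj₂ (label-range v u (∼-sym e))))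
    (+-monoʳ-≤ n (m≤m+n n (q * n)))))

-- Relabeling by an invertible factor.

module _ {n : ℕ} .{{_ : NonZero n}} {α β : ℤ}
         (βα≡1 : β ℤ.* α ≡ 1ℤ [mod n ]) where

  mulMod-injective : ∀ {x y} → x < n → y < n → mulMod n α x ≡ mulMod n α y → x ≡ y
  mulMod-injective x<n y<n eq = trans (sym (mulMod-inverse n {α} {β} βα≡1 x<n))
    (trans (cong (mulMod n β) eq) (mulMod-inverse n {α} {β} βα≡1 y<n))

  -- If `α x` vanished modulo `n`, multiplying by `β` would give `x = 0`. Hence no label is sent to
  -- 0.
  mulMod-positive : ∀ {x} → 1 ≤ x → x < n → 1 ≤ mulMod n α x
  mulMod-positive {x} 1≤x x<n = n≢0⇒n>0 λ αx≡0 → >⇒≢ 1≤x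
    (trans (sym (mulMod-inverse n {α} {β} βα≡1 x<n))
    (trans (cong (mulMod n β) αx≡0)
    (trans (cong (_%ℕ n) (ℤ.*-zeroʳ β)) (m<n⇒m%n≡m (≤-<-trans z≤n x<n)))))

  multiplication : Permutation′ n
  multiplication = permutation (scale α) (scale β)
    (scale-inverse β α (subst (_≡ 1ℤ [mod n ]) (ℤ.*-comm β α) βα≡1))
    (scale-inverse α β βα≡1)
    where
    scale : ℤ → Fin n → Fin n
    scale δ i = fromℕ< (mulMod<n n δ (toℕ i))

    scale-inverse : ∀ δ ε → ε ℤ.* δ ≡ 1ℤ [mod n ] → ∀ i → scale ε (scale δ i) ≡ i
    scale-inverse δ ε εδ≡1 i = toℕ-injective
      (trans (toℕ-fromℕ< _)
      (trans (cong (mulMod n ε) (toℕ-fromℕ< _))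
             (mulMod-inverse n {δ} {ε} εδ≡1 (toℕ<n i))))

  module _ {G : Graph n} {lab : EdgeLabeling G} where
    open Graph G using (_∼_) renaming (sym to ∼-sym)

    -- Defined from the old labels rather than from the new ranks, so that the labels used are the
    -- image of the old ones by definition.
    scaled : EdgeLabeling G
    scaled u v e = mulMod n α (lab u v e)

    -- Multiplying the congruence for the old label by `α` gives a difference of multiples of ranks;
    -- each multiple is then replaced by its residue, the new rank.
    scaled-isCSD : IsCSD G lab → IsCSD G scaled
    scaled-isCSD csd = record
      { rank        = rank ∘ₚ multiplication
      ; label-range = λ u v e →
          let 1≤l , l<n = label-range u v e
          in mulMod-positive 1≤l l<n , mulMod<n n α (lab u v e)
      ; label-diff  = λ u v e →
          subst (λ z → + scaled u v e ≡ z [mod n ]) (sym (cong₂ ℤ._-_ (rank′ v) (rank′ u)))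
            (mod-trans (+ scaled u v e) (α ℤ.* + lab u v e) (s v ℤ.- s u)
              (mulMod-cong n α (lab u v e))
            (mod-trans (α ℤ.* + lab u v e) (α ℤ.* (r v ℤ.- r u)) (s v ℤ.- s u)
              (mod-*-congˡ α (+ lab u v e) (r v ℤ.- r u) (label-diff u v e))
            -- Subtraction in ℤ is addition of a negative by definition, so after distributing `α`
            -- the congruences for sums and negatives apply.
            (subst (λ z → z ≡ s v ℤ.- s u [mod n ]) (sym (lemma α (r v) (r u)))
              (mod-+-cong (α ℤ.* r v) (s v) (ℤ.- (α ℤ.* r u)) (ℤ.- s u)
                (s-cong v) (mod-neg-cong (α ℤ.* r u) (s u) (s-cong u))))))
      }
      where
      open IsCSD csd

      s : Fin n → ℤ
      s u = + mulMod n α (toℕ (rank ⟨$⟩ʳ u))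

      rank′ : ∀ u → + toℕ ((rank ∘ₚ multiplication) ⟨$⟩ʳ u) ≡ s u
      rank′ u = cong +_ (toℕ-fromℕ< _)

      s-cong : ∀ u → α ℤ.* r u ≡ s u [mod n ]
      s-cong u = mod-sym (s u) (α ℤ.* r u) (mulMod-cong n α (toℕ (rank ⟨$⟩ʳ u)))

      lemma : ∀ a x y → a ℤ.* (x ℤ.- y) ≡ a ℤ.* x ℤ.+ ℤ.- (a ℤ.* y)
      lemma = solve-∀

    used<n : IsCSD G lab → ∀ {x} → Used G lab x → x < n
    used<n csd (u , v , e , refl) = proj₂ (IsCSD.label-range csd u v e)

    scaled-used : ∀ {x} → Used G lab x → Used G scaled (mulMod n α x)
    scaled-used (u , v , e , refl) = u , v , e , refl

    -- Mapping the list of old labels keeps its length, and keeps it free of repetitions by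
    -- injectivity on residues; `Δ G` depends on the graph alone.
    scaled-isMCSD : IsMCSD G lab → IsMCSD G scaled
    scaled-isMCSD mcsd = record
      { isCSD   = scaled-isCSD isCSD
      ; minimal =
          let xs , xs! , length≡Δ , xs⇔ = minimal in
          map (mulMod n α) xs
          , Unique-map⁺ mulMod-injective
              (All.tabulate (used<n isCSD ∘ to (xs⇔ _))) xs!
          , trans (length-map _ xs) length≡Δ
          , λ y → mk⇔
              (λ y∈ → let x , x∈xs , y≡ = ∈-map⁻ (mulMod n α) y∈ in
                subst (Used G scaled) (sym y≡) (scaled-used (to (xs⇔ x) x∈xs)))
              (λ { (u , v , e , refl) →
                ∈-map⁺ (mulMod n α) (from (xs⇔ _) (u , v , e , refl)) })
      }
      where open IsMCSD mcsd

    -- The new labels at most n/2.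

    module _ {m : ℕ} (csd : IsCSD G lab) (γ : Fin m → ℕ) (draws : DrawsOn G lab γ) where

      private
        γ-used : ∀ i → Used G lab (γ i)
        γ-used i = proj₁ (to (draws (γ i)) (i , refl))

        γ-small : ∀ i → 2 * γ i ≤ n
        γ-small i = proj₂ (to (draws (γ i)) (i , refl))

      -- A value above n/2 folds to the scaled label at the other end of the same edge, so the
      -- folded value is used as well.
      rescale-used : ∀ {x} → Used G lab x →
                     Used G scaled (rescale n α x) × 2 * rescale n α x ≤ n
      rescale-used {x} (u , v , e , refl) with 2 * mulMod n α x ≤? n
      ... | yes small = subst (λ y → Used G scaled y × 2 * y ≤ n)
        (sym (rescale-small n α x small)) ((u , v , e , refl) , small)
      ... | no large = subst (λ y → Used G scaled y × 2 * y ≤ n)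
        (trans complement (sym (rescale-large n α x large)))
        ((v , u , ∼-sym e , refl) , complement-small {a = scaled u v e} sum≡n large)
        where
        sum≡n = reverse-label (scaled-isCSD csd) e
        complement : scaled v u (∼-sym e) ≡ n ∸ scaled u v e
        complement = trans (sym (m+n∸m≡n (scaled u v e) _)) (cong (_∸ scaled u v e) sum≡n)

      scaled-drawsOn : DrawsOn G scaled (rescale n α ∘ γ)
      scaled-drawsOn x = mk⇔
        (λ { (i , refl) → rescale-used (γ-used i) })
        (λ { ((u , v , e , refl) , small) → preimage e small })
        where
        -- If the old label at `u` exceeds n/2, the old label at `v` does not, and so is some `γ i`.
        -- Its multiple then folds onto the scaled label at `u`.
        preimage : ∀ {u v} (e : u ∼ v) → 2 * scaled u v e ≤ n →
                   ∃ λ i → rescale n α (γ i) ≡ scaled u v e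
        preimage {u} {v} e small with 2 * lab u v e ≤? n
        ... | yes 2l≤n =
          let i , γi≡l = from (draws _) ((u , v , e , refl) , 2l≤n) in
          i , trans (cong (rescale n α) γi≡l) (rescale-small n α (lab u v e) small)
        ... | no 2l≰n =
          let i , γi≡l = from (draws _) ((v , u , e⁻¹ , refl)
                           , complement-small {a = lab u v e} (reverse-label csd e) 2l≰n) in
          i , trans (cong (rescale n α) γi≡l) folded
          where
          e⁻¹ = ∼-sym e
          sum≡n = reverse-label (scaled-isCSD csd) e
          folded : rescale n α (lab v u e⁻¹) ≡ scaled u v e
          folded with 2 * scaled v u e⁻¹ ≤? n
          -- Two scaled labels at most n/2 with sum `n` coincide, so no folding takes place.
          ... | yes small′ = trans (rescale-small n α _ small′)
            (sym (halves-equal small small′ sum≡n))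
          ... | no large′ = trans (rescale-large n α _ large′)
            (trans (cong (_∸ scaled v u e⁻¹) (sym sum≡n))
                   (m+n∸n≡m (scaled u v e) (scaled v u e⁻¹)))

      rescale-injective : Injective _≡_ _≡_ γ → Injective _≡_ _≡_ (rescale n α ∘ γ)
      rescale-injective γ-inj {i} {j} eq =
        γ-inj (used-equal (γ-used i) (γ-used j) (γ-small i) (γ-small j) eq)
        where
        -- `n ∸ α y` is the scaled label at the far end of an edge labeled `y`. Injectivity makes
        -- `x` the old label there, so `x + y = n`. Arbitrary used labels stand in for `γ i` and
        -- `γ j` so that the witnessing edge can be matched with `refl`.
        opposite : ∀ {x y} → Used G lab x → Used G lab y → 2 * x ≤ n → 2 * y ≤ n →
                   mulMod n α x ≡ n ∸ mulMod n α y → x ≡ y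
        opposite {x} x-used y-used@(u , v , e , refl) 2x≤n 2y≤n αx≡n-αy =
          halves-equal 2x≤n 2y≤n
            (trans (cong (_+ lab u v e) x≡l)
            (trans (+-comm l (lab u v e)) (reverse-label csd e)))
          where
          l = lab v u (∼-sym e)
          x≡l : x ≡ l
          x≡l = mulMod-injective (used<n csd x-used) (used<n csd (v , u , ∼-sym e , refl))
            (trans αx≡n-αy
            (trans (cong (_∸ scaled u v e) (sym (reverse-label (scaled-isCSD csd) e)))
                   (m+n∸m≡n (scaled u v e) _)))

        used-equal : ∀ {x y} → Used G lab x → Used G lab y → 2 * x ≤ n → 2 * y ≤ n →
                     rescale n α x ≡ rescale n α y → x ≡ y
        used-equal {x} {y} x-used y-used 2x≤n 2y≤n eq
          with 2 * mulMod n α x ≤? n | 2 * mulMod n α y ≤? n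
        ... | yes p | yes q = mulMod-injective (used<n csd x-used) (used<n csd y-used)
          (trans (sym (rescale-small n α x p)) (trans eq (rescale-small n α y q)))
        ... | yes p | no q = opposite x-used y-used 2x≤n 2y≤n
          (trans (sym (rescale-small n α x p)) (trans eq (rescale-large n α y q)))
        ... | no p | yes q = sym (opposite y-used x-used 2y≤n 2x≤n
          (trans (sym (rescale-small n α y q)) (trans (sym eq) (rescale-large n α x p))))
        ... | no p | no q = mulMod-injective (used<n csd x-used) (used<n csd y-used)
          -- Truncated subtraction from `n` cancels because both residues are below `n`.
          (∸-cancelˡ-≡ (<⇒≤ (mulMod<n n α x)) (<⇒≤ (mulMod<n n α y))
            (trans (sym (rescale-large n α x p)) (trans eq (rescale-large n α y q))))

theorem10 : ∀ (n k : ℕ) .{{_ : NonZero n}} (G : Graph n) → Regular G k →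
    (lab : EdgeLabeling G) → IsMCSD G lab →
    (γ : Fin ⌈ k /2⌉ → ℕ) → γ Preserves Fin._<_ ⟶ _<_ → DrawsOn G lab γ →
    (α : ℤ) → (+ 2) ℤ.* α ℤ.< + n → gcd α (+ n) ≡ 1ℤ →
    (Σ[ lab′ ∈ EdgeLabeling G ] IsMCSD G lab′ × DrawsOn G lab′ (rescale n α ∘ γ))
      × Injective _≡_ _≡_ (rescale n α ∘ γ)
theorem10 n k G _ lab mcsd γ γ-mono draws α _ gcd≡1 =
  let β , βα≡1 = mod-inverse n α gcd≡1
      csd      = IsMCSD.isCSD mcsd
  in ( scaled {α = α} {β} βα≡1 {G = G} {lab = lab}
     , scaled-isMCSD {α = α} {β} βα≡1 mcsd
     , scaled-drawsOn {α = α} {β} βα≡1 csd γ draws )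
     , rescale-injective {α = α} {β} βα≡1 csd γ draws (monotone⇒injective γ γ-mono)
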